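{- Let $a_1,\dots,a_m$ be a non-negative log-concave sequence satisfying $a_k\le\frac1k$ for each $k\in\{1,\dots,m\}$. Then $a_1+\dots+a_m<e$.
   Context: A non-negative sequence $a_1,\dots,a_m$ is log-concave if $a_k^2\ge a_{k-1}a_{k+1}$ for $1<k<m$ and the indices $k$ with $a_k>0$ form a (possibly empty) set of consecutive integers. -}

module Defs where

open import Level using (0ℓ)
open import Data.Nat as ℕ using (ℕ; zero; suc)

open import Data.Product using (∃; _×_)
open import Data.Sum using (_⊎_)
open import Relation.Binary.PropositionalEquality using (_≡_)
open import Relation.Nullary using (¬_)
import Algebra.Structures as AS
import Relation.Binary.Structures as RS

-- The real numbers, axiomatised as a (Dedekind-)complete ordered field
-- (unique up to isomorphism).
-- Division is a total operation _⁻¹ whose value at 0 is unspecified.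
record CompleteOrderedField : Set₁ where
  infixl 6 _+_
  infixl 7 _*_
  infix 4 _<_ _≤_
  field
    R   : Set
    _+_ _*_ : R → R → R
    -_  : R → R
    0# 1# : R
    _⁻¹ : R → R
    _<_ : R → R → Set
    isCommutativeRing : AS.IsCommutativeRing {A = R} _≡_ _+_ _*_ -_ 0# 1#
    0≢1 : ¬ (0# ≡ 1#)
    ⁻¹-inverse : ∀ x → ¬ (x ≡ 0#) → x * (x ⁻¹) ≡ 1#
    isStrictTotalOrder : RS.IsStrictTotalOrder {A = R} _≡_ _<_
    +-mono-< : ∀ {x y} z → x < y → x + z < y + z
    *-pos    : ∀ {x y} → 0# < x → 0# < y → 0# < x * y

  _≤_ : R → R → Set
  x ≤ y = (x < y) ⊎ (x ≡ y)

  field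
    complete : (P : R → Set) → ∃ P → ∃ (λ b → ∀ x → P x → x ≤ b) →
               ∃ (λ s → (∀ x → P x → x ≤ s) ×
                        (∀ b → (∀ x → P x → x ≤ b) → s ≤ b))

  ι : ℕ → R
  ι zero    = 0#
  ι (suc n) = 1# + ι n

  -- Σ_{k=lo}^{lo+len-1} f k
  sumFrom : ℕ → ℕ → (ℕ → R) → R
  sumFrom lo zero      f = 0#
  sumFrom lo (suc len) f = f lo + sumFrom (suc lo) len f

  IsSup : (R → Set) → R → Set
  IsSup P s = (∀ x → P x → x ≤ s) × (∀ b → (∀ x → P x → x ≤ b) → s ≤ b)

  IsEuler : R → Set
  IsEuler e = IsSup (λ x → ∃ λ N → x ≡ sumFrom 0 (suc N) (λ j → (ι (j ℕ.!)) ⁻¹)) e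

  -- a_1,…,a_m (only indices 1..m of a : ℕ → R matter) is non-negative
  -- and log-concave in the sense of the paper.
  NonNeg : ℕ → (ℕ → R) → Set
  NonNeg m a = ∀ k → 1 ℕ.≤ k → k ℕ.≤ m → 0# ≤ a k

  LogConcave : ℕ → (ℕ → R) → Set
  LogConcave m a =
    NonNeg m a ×
    (∀ k → 1 ℕ.< k → k ℕ.< m → a (ℕ.pred k) * a (suc k) ≤ a k * a k) ×
    -- the indices k with a_k > 0 form a set of consecutive integers
    (∀ i j k → 1 ℕ.≤ i → i ℕ.≤ j → j ℕ.≤ k → k ℕ.≤ m →
       0# < a i → 0# < a k → 0# < a j)

-- Let n = p + 1 maximise k·a_k on 1..m and put A = a_n; if A = 0
-- the whole sequence vanishes.  Log-concavity with consecutive support makes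
-- the ratios a_{k+1}/a_k non-increasing (ratio-antitone).  Together with the
-- maximality of n this gives p·a_k ≤ n·a_{k+1} below n and
-- (n+1)·a_{k+1} ≤ n·a_k above n, so the head and the tail of the sum are
-- dominated by geometric sums (geometricHead, geometricTail).  Using n·A ≤ 1
-- they add up to Σ a_k ≤ (1 + 1/p)^p + 1/(p+1), proved in the cleared form
-- n·p^p·Σ a_k ≤ n^(p+1) + p^p (scaledSumBound).  By the binomial theorem and
-- C(p,k)/p^k ≤ 1/k!, the right-hand side is at most Σ_{j ≤ p+3} 1/j!, the terms
-- j = 2, 3 absorbing 1/(p+1) (compoundBound, scaledEulerBound); and every
-- partial sum of e lies strictly below e.
module Submission where

open import Level using (0ℓ)
open import Defs
open import Data.Nat as ℕ using (ℕ; zero; suc; z≤n; s≤s; _∸_)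
import Data.Nat.Properties as NP
open import Data.Product using (∃; _×_; _,_; proj₁; proj₂)
open import Data.Sum using (_⊎_; inj₁; inj₂)
open import Data.Empty using (⊥-elim)
open import Relation.Nullary using (¬_)
open import Relation.Binary.PropositionalEquality
open import Relation.Binary.Bundles using (StrictTotalOrder)
open import Relation.Binary.Definitions using (tri<; tri≈; tri>)
import Relation.Binary.Construct.StrictToNonStrict as NonStrict
import Relation.Binary.Reasoning.StrictPartialOrder
open import Algebra.Bundles using (CommutativeRing; CommutativeSemiring)
import Algebra.Structures as AS
import Relation.Binary.Structures as RS

cong₃ : ∀ {A B C D : Set} (f : A → B → C → D) {a a′ b b′ c c′} →
        a ≡ a′ → b ≡ b′ → c ≡ c′ → f a b c ≡ f a′ b′ c′
cong₃ f refl refl refl = refl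

module BinomialCoefficients where
  open import Data.Nat.Solver using (module +-*-Solver)
  open +-*-Solver

  -- Binomial coefficients by Pascal's rule.  (The library's _C_ is
  -- defined through division, which is awkward for the inductions below.)
  binom : ℕ → ℕ → ℕ
  binom n       zero    = 1
  binom zero    (suc k) = 0
  binom (suc n) (suc k) = binom n k ℕ.+ binom n (suc k)

  binom-1 : ∀ n → binom n 1 ≡ n
  binom-1 zero    = refl
  binom-1 (suc n) = cong suc (binom-1 n)

  binom-absorb : ∀ n k → suc k ℕ.* binom (suc n) (suc k) ≡ suc n ℕ.* binom n k
  binom-absorb n       zero    =
    trans (NP.*-identityˡ (binom (suc n) 1)) (trans (binom-1 (suc n)) (sym (NP.*-identityʳ (suc n))))
  binom-absorb zero    (suc k) = NP.*-zeroʳ (suc (suc k))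
  binom-absorb (suc n) (suc k) = begin
    suc (suc k) ℕ.* (c ℕ.+ c′)
      ≡⟨ solve 3 (λ k c c′ → (con 2 :+ k) :* (c :+ c′) := ((con 1 :+ k) :* c :+ c) :+ (con 2 :+ k) :* c′) refl k c c′ ⟩
    (suc k ℕ.* c ℕ.+ c) ℕ.+ suc (suc k) ℕ.* c′
      ≡⟨ cong₂ (λ s t → (s ℕ.+ c) ℕ.+ t) (binom-absorb n k) (binom-absorb n (suc k)) ⟩
    (suc n ℕ.* u ℕ.+ (u ℕ.+ v)) ℕ.+ suc n ℕ.* v
      ≡⟨ solve 3 (λ n u v → ((con 1 :+ n) :* u :+ (u :+ v)) :+ (con 1 :+ n) :* v := (con 2 :+ n) :* (u :+ v)) refl n u v ⟩
    suc (suc n) ℕ.* (u ℕ.+ v) ∎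
    where
    open ≡-Reasoning
    u = binom n k
    v = binom n (suc k)
    c = binom (suc n) (suc k)
    c′ = binom (suc n) (suc (suc k))

  -- C(p,k)·k! ≤ p^k: the k-th binomial term of (1 + 1/p)^p is at most 1/k!.
  binom*!≤^ : ∀ p k → binom p k ℕ.* k ℕ.! ℕ.≤ p ℕ.^ k
  binom*!≤^ p       zero    = NP.≤-refl
  binom*!≤^ zero    (suc k) = z≤n
  binom*!≤^ (suc q) (suc k) = begin
    binom (suc q) (suc k) ℕ.* (suc k ℕ.* k ℕ.!)
      ≡⟨ solve 3 (λ c k f → c :* ((con 1 :+ k) :* f) := ((con 1 :+ k) :* c) :* f) refl (binom (suc q) (suc k)) k (k ℕ.!) ⟩
    (suc k ℕ.* binom (suc q) (suc k)) ℕ.* k ℕ.!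
      ≡⟨ cong (ℕ._* k ℕ.!) (binom-absorb q k) ⟩
    (suc q ℕ.* binom q k) ℕ.* k ℕ.!
      ≡⟨ NP.*-assoc (suc q) (binom q k) (k ℕ.!) ⟩
    suc q ℕ.* (binom q k ℕ.* k ℕ.!)
      ≤⟨ NP.*-monoʳ-≤ (suc q) (NP.≤-trans (binom*!≤^ q k) (NP.^-monoˡ-≤ k (NP.n≤1+n q))) ⟩
    suc q ℕ.* suc q ℕ.^ k ∎
    where open NP.≤-Reasoning

  2*binom2 : ∀ r → 2 ℕ.* binom (suc r) 2 ≡ suc r ℕ.* r
  2*binom2 r = trans (binom-absorb r 1) (cong (suc r ℕ.*_) (binom-1 r))

  6*binom3 : ∀ s → 6 ℕ.* binom (2 ℕ.+ s) 3 ≡ (2 ℕ.+ s) ℕ.* ((1 ℕ.+ s) ℕ.* s)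
  6*binom3 s = begin
    6 ℕ.* binom (2 ℕ.+ s) 3              ≡⟨ NP.*-assoc 2 3 (binom (2 ℕ.+ s) 3) ⟩
    2 ℕ.* (3 ℕ.* binom (2 ℕ.+ s) 3)      ≡⟨ cong (2 ℕ.*_) (binom-absorb (suc s) 2) ⟩
    2 ℕ.* ((2 ℕ.+ s) ℕ.* binom (1 ℕ.+ s) 2) ≡⟨ solve 2 (λ s c → con 2 :* ((con 2 :+ s) :* c) := (con 2 :+ s) :* (con 2 :* c)) refl s (binom (1 ℕ.+ s) 2) ⟩
    (2 ℕ.+ s) ℕ.* (2 ℕ.* binom (1 ℕ.+ s) 2) ≡⟨ cong ((2 ℕ.+ s) ℕ.*_) (2*binom2 s) ⟩
    (2 ℕ.+ s) ℕ.* ((1 ℕ.+ s) ℕ.* s) ∎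
    where open ≡-Reasoning

  -- The integer form of C(p,2)/p² + C(p,3)/p³ + 1/(p+1) ≤ 1/2 + 1/6 for
  -- p ≥ 1, obtained by multiplying through by 6p³(p+1).  For p ≥ 2 insert
  -- 2·C(p,2) = p(p-1) and 6·C(p,3) = p(p-1)(p-2); the two sides then differ
  -- by exactly p(4p-2).
  lowTermsSlack : ∀ p → 1 ℕ.≤ p →
    6 ℕ.* suc p ℕ.* p ℕ.* binom p 2 ℕ.+ 6 ℕ.* suc p ℕ.* binom p 3 ℕ.+ 6 ℕ.* p ℕ.* p ℕ.* p
      ℕ.≤ 4 ℕ.* p ℕ.* p ℕ.* p ℕ.* suc p
  lowTermsSlack (suc zero)    _ = NP.m≤m+n 6 2
  lowTermsSlack (suc (suc s)) _ = begin
    6 ℕ.* n ℕ.* p ℕ.* c2 ℕ.+ 6 ℕ.* n ℕ.* c3 ℕ.+ 6 ℕ.* p ℕ.* p ℕ.* p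
      ≡⟨ solve 4 (λ n p c2 c3 → con 6 :* n :* p :* c2 :+ con 6 :* n :* c3 :+ con 6 :* p :* p :* p
                              := con 3 :* n :* p :* (con 2 :* c2) :+ n :* (con 6 :* c3) :+ con 6 :* p :* p :* p) refl n p c2 c3 ⟩
    3 ℕ.* n ℕ.* p ℕ.* (2 ℕ.* c2) ℕ.+ n ℕ.* (6 ℕ.* c3) ℕ.+ 6 ℕ.* p ℕ.* p ℕ.* p
      ≡⟨ cong₂ (λ u v → 3 ℕ.* n ℕ.* p ℕ.* u ℕ.+ n ℕ.* v ℕ.+ 6 ℕ.* p ℕ.* p ℕ.* p) (2*binom2 (suc s)) (6*binom3 s) ⟩
    3 ℕ.* n ℕ.* p ℕ.* (p ℕ.* suc s) ℕ.+ n ℕ.* (p ℕ.* (suc s ℕ.* s)) ℕ.+ 6 ℕ.* p ℕ.* p ℕ.* p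
      ≤⟨ NP.m≤m+n _ (2 ℕ.* p ℕ.* (3 ℕ.+ 2 ℕ.* s)) ⟩
    3 ℕ.* n ℕ.* p ℕ.* (p ℕ.* suc s) ℕ.+ n ℕ.* (p ℕ.* (suc s ℕ.* s)) ℕ.+ 6 ℕ.* p ℕ.* p ℕ.* p ℕ.+ 2 ℕ.* p ℕ.* (3 ℕ.+ 2 ℕ.* s)
      ≡⟨ solve 1 (λ s → con 3 :* (con 3 :+ s) :* (con 2 :+ s) :* ((con 2 :+ s) :* (con 1 :+ s))
                        :+ (con 3 :+ s) :* ((con 2 :+ s) :* ((con 1 :+ s) :* s))
                        :+ con 6 :* (con 2 :+ s) :* (con 2 :+ s) :* (con 2 :+ s)
                        :+ con 2 :* (con 2 :+ s) :* (con 3 :+ con 2 :* s)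
                     := con 4 :* (con 2 :+ s) :* (con 2 :+ s) :* (con 2 :+ s) :* (con 3 :+ s)) refl s ⟩
    4 ℕ.* p ℕ.* p ℕ.* p ℕ.* n ∎
    where
    open NP.≤-Reasoning
    p = suc (suc s)
    n = suc p
    c2 = binom p 2
    c3 = binom p 3

open BinomialCoefficients

module _ (F : CompleteOrderedField) where
  open CompleteOrderedField F
  open AS.IsCommutativeRing isCommutativeRing
    using (+-comm; +-assoc; *-comm; *-assoc; distribˡ; distribʳ; zeroˡ; zeroʳ;
           +-identityˡ; +-identityʳ; *-identityˡ; *-identityʳ; -‿inverseʳ; -‿inverseˡ)
  open RS.IsStrictTotalOrder isStrictTotalOrder
    using (compare; <-resp-≈) renaming (trans to <-trans; irrefl to <-irrefl)

  ring : CommutativeRing 0ℓ 0ℓ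
  ring = record { isCommutativeRing = isCommutativeRing }

  strictTotalOrder : StrictTotalOrder 0ℓ 0ℓ 0ℓ
  strictTotalOrder = record { isStrictTotalOrder = isStrictTotalOrder }

  open CommutativeRing ring using (commutativeSemiring)
  open CommutativeSemiring commutativeSemiring using (rawSemiring)
  open import Algebra.Definitions.RawSemiring rawSemiring using (_^_)
  open import Algebra.Properties.CommutativeSemiring.Exp commutativeSemiring using (^-distrib-*)
  open import Algebra.Properties.Ring (CommutativeRing.ring ring) using (-1*x≈-x; -‿involutive)
  open import Algebra.Solver.Ring.NaturalCoefficients.Default commutativeSemiring
  open import Relation.Binary.Properties.StrictTotalOrder strictTotalOrder
    using () renaming (refl to ≤-refl; trans to ≤-trans; reflexive to ≤-reflexive)
  module ≤-Reasoning = Relation.Binary.Reasoning.StrictPartialOrder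
                         (StrictTotalOrder.strictPartialOrder strictTotalOrder)

  <-≤-trans : ∀ {x y z} → x < y → y ≤ z → x < z
  <-≤-trans = NonStrict.<-≤-trans _≡_ _<_ <-trans (proj₁ <-resp-≈)

  ≤-<-trans : ∀ {x y z} → x ≤ y → y < z → x < z
  ≤-<-trans = NonStrict.≤-<-trans _≡_ _<_ sym <-trans (proj₂ <-resp-≈)

  ≤-or-> : ∀ x y → (x ≤ y) ⊎ (y < x)
  ≤-or-> x y with compare x y
  ... | tri< x<y _ _ = inj₁ (inj₁ x<y)
  ... | tri≈ _ x≡y _ = inj₁ (inj₂ x≡y)
  ... | tri> _ _ y<x = inj₂ y<x

  +-monoˡ-≤ : ∀ {x y} z → x ≤ y → x + z ≤ y + z
  +-monoˡ-≤ z (inj₁ x<y)  = inj₁ (+-mono-< z x<y)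
  +-monoˡ-≤ z (inj₂ refl) = ≤-refl

  +-monoʳ-< : ∀ {x y} z → x < y → z + x < z + y
  +-monoʳ-< {x} {y} z x<y = subst₂ _<_ (+-comm x z) (+-comm y z) (+-mono-< z x<y)

  +-monoʳ-≤ : ∀ {x y} z → x ≤ y → z + x ≤ z + y
  +-monoʳ-≤ {x} {y} z x≤y = subst₂ _≤_ (+-comm x z) (+-comm y z) (+-monoˡ-≤ z x≤y)

  +-mono-≤ : ∀ {a b c d} → a ≤ b → c ≤ d → a + c ≤ b + d
  +-mono-≤ {b = b} {c} a≤b c≤d = ≤-trans (+-monoˡ-≤ c a≤b) (+-monoʳ-≤ b c≤d)

  +-nonneg : ∀ {x y} → 0# ≤ x → 0# ≤ y → 0# ≤ x + y
  +-nonneg {x} {y} 0≤x 0≤y = subst (_≤ x + y) (+-identityˡ 0#) (+-mono-≤ 0≤x 0≤y)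

  -- 0 < 1: otherwise 0 < -1, and then 0 < (-1)(-1) = 1.
  0<1 : 0# < 1#
  0<1 with compare 0# 1#
  ... | tri< 0<1 _ _ = 0<1
  ... | tri≈ _ 0≡1 _ = ⊥-elim (0≢1 0≡1)
  ... | tri> _ _ 1<0 = ⊥-elim (<-irrefl refl (<-trans 1<0 0<[-1]²))
    where
    0<-1 : 0# < - 1#
    0<-1 = subst₂ _<_ (-‿inverseʳ 1#) (+-identityˡ (- 1#)) (+-mono-< (- 1#) 1<0)
    0<[-1]² : 0# < 1#
    0<[-1]² = subst (0# <_) (trans (-1*x≈-x (- 1#)) (-‿involutive 1#)) (*-pos 0<-1 0<-1)

  -- Multiplication by a positive element is strictly monotone, since
  -- y·z - x·z = (y - x)·z is a product of positives.
  *-monoʳ-< : ∀ {x y z} → 0# < z → x < y → x * z < y * z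
  *-monoʳ-< {x} {y} {z} 0<z x<y =
    subst₂ _<_ (+-identityˡ (x * z)) factor (+-mono-< (x * z) (*-pos 0<y-x 0<z))
    where
    0<y-x : 0# < y + - x
    0<y-x = subst (_< y + - x) (-‿inverseʳ x) (+-mono-< (- x) x<y)
    factor : (y + - x) * z + x * z ≡ y * z
    factor = begin
      (y + - x) * z + x * z      ≡⟨ cong (_+ x * z) (distribʳ z y (- x)) ⟩
      (y * z + - x * z) + x * z  ≡⟨ +-assoc (y * z) (- x * z) (x * z) ⟩
      y * z + (- x * z + x * z)  ≡⟨ cong (y * z +_) (sym (distribʳ z (- x) x)) ⟩
      y * z + (- x + x) * z      ≡⟨ cong (λ t → y * z + t * z) (-‿inverseˡ x) ⟩
      y * z + 0# * z             ≡⟨ cong (y * z +_) (zeroˡ z) ⟩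
      y * z + 0#                 ≡⟨ +-identityʳ (y * z) ⟩
      y * z                      ∎
      where open ≡-Reasoning

  *-monoˡ-< : ∀ {x y z} → 0# < z → x < y → z * x < z * y
  *-monoˡ-< {x} {y} {z} 0<z x<y = subst₂ _<_ (*-comm x z) (*-comm y z) (*-monoʳ-< 0<z x<y)

  *-monoʳ-≤ : ∀ {x y z} → 0# ≤ z → x ≤ y → x * z ≤ y * z
  *-monoʳ-≤ {x} {y} (inj₂ refl) _ = inj₂ (trans (zeroʳ x) (sym (zeroʳ y)))
  *-monoʳ-≤ (inj₁ 0<z) (inj₁ x<y)  = inj₁ (*-monoʳ-< 0<z x<y)
  *-monoʳ-≤ (inj₁ 0<z) (inj₂ refl) = ≤-refl

  *-monoˡ-≤ : ∀ {x y z} → 0# ≤ z → x ≤ y → z * x ≤ z * y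
  *-monoˡ-≤ {x} {y} {z} 0≤z x≤y = subst₂ _≤_ (*-comm x z) (*-comm y z) (*-monoʳ-≤ 0≤z x≤y)

  *-cancelʳ-≤ : ∀ {x y z} → 0# < z → x * z ≤ y * z → x ≤ y
  *-cancelʳ-≤ {x} {y} 0<z xz≤yz with ≤-or-> x y
  ... | inj₁ x≤y = x≤y
  ... | inj₂ y<x = ⊥-elim (<-irrefl refl (≤-<-trans xz≤yz (*-monoʳ-< 0<z y<x)))

  *-cancelˡ-≤ : ∀ {x y z} → 0# < z → z * x ≤ z * y → x ≤ y
  *-cancelˡ-≤ {x} {y} {z} 0<z zx≤zy = *-cancelʳ-≤ 0<z (subst₂ _≤_ (*-comm z x) (*-comm z y) zx≤zy)

  *-nonneg : ∀ {x y} → 0# ≤ x → 0# ≤ y → 0# ≤ x * y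
  *-nonneg {x} {y} 0≤x 0≤y = subst (_≤ x * y) (zeroˡ y) (*-monoʳ-≤ 0≤y 0≤x)

  pos⇒≢0 : ∀ {x} → 0# < x → ¬ (x ≡ 0#)
  pos⇒≢0 0<x refl = <-irrefl refl 0<x

  ⁻¹-pos : ∀ {x} → 0# < x → 0# < x ⁻¹
  ⁻¹-pos {x} 0<x with compare 0# (x ⁻¹)
  ... | tri< 0<x⁻¹ _ _ = 0<x⁻¹
  ... | tri≈ _ 0≡x⁻¹ _ =
    ⊥-elim (0≢1 (trans (sym (zeroʳ x)) (trans (cong (x *_) 0≡x⁻¹) (⁻¹-inverse x (pos⇒≢0 0<x)))))
  ... | tri> _ _ x⁻¹<0 =
    ⊥-elim (<-irrefl refl (<-trans 0<1 (subst₂ _<_ (⁻¹-inverse x (pos⇒≢0 0<x)) (zeroʳ x) (*-monoˡ-< 0<x x⁻¹<0))))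

  ⁻¹-unique : ∀ {x y} → 0# < x → x * y ≡ 1# → y ≡ x ⁻¹
  ⁻¹-unique {x} {y} 0<x xy≡1 = begin
    y                  ≡⟨ sym (*-identityʳ y) ⟩
    y * 1#             ≡⟨ cong (y *_) (sym (⁻¹-inverse x (pos⇒≢0 0<x))) ⟩
    y * (x * x ⁻¹)     ≡⟨ sym (*-assoc y x (x ⁻¹)) ⟩
    (y * x) * x ⁻¹     ≡⟨ cong (_* x ⁻¹) (trans (*-comm y x) xy≡1) ⟩
    1# * x ⁻¹          ≡⟨ *-identityˡ (x ⁻¹) ⟩
    x ⁻¹               ∎
    where open ≡-Reasoning

  ι-+ : ∀ a b → ι (a ℕ.+ b) ≡ ι a + ι b
  ι-+ zero    b = sym (+-identityˡ (ι b))
  ι-+ (suc a) b = trans (cong (1# +_) (ι-+ a b)) (sym (+-assoc 1# (ι a) (ι b)))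

  ι-* : ∀ a b → ι (a ℕ.* b) ≡ ι a * ι b
  ι-* zero    b = sym (zeroˡ (ι b))
  ι-* (suc a) b = begin
    ι (b ℕ.+ a ℕ.* b)  ≡⟨ ι-+ b (a ℕ.* b) ⟩
    ι b + ι (a ℕ.* b)  ≡⟨ cong (ι b +_) (ι-* a b) ⟩
    ι b + ι a * ι b    ≡⟨ solve 2 (λ u v → v :+ u :* v := (con 1 :+ u) :* v) refl (ι a) (ι b) ⟩
    (1# + ι a) * ι b   ∎
    where open ≡-Reasoning

  ι-*₃ : ∀ a b c → ι (a ℕ.* b ℕ.* c) ≡ ι a * ι b * ι c
  ι-*₃ a b c = trans (ι-* (a ℕ.* b) c) (cong (_* ι c) (ι-* a b))

  ι-*₄ : ∀ a b c d → ι (a ℕ.* b ℕ.* c ℕ.* d) ≡ ι a * ι b * ι c * ι d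
  ι-*₄ a b c d = trans (ι-* (a ℕ.* b ℕ.* c) d) (cong (_* ι d) (ι-*₃ a b c))

  ι-^ : ∀ a k → ι (a ℕ.^ k) ≡ ι a ^ k
  ι-^ a zero    = +-identityʳ 1#
  ι-^ a (suc k) = trans (ι-* a (a ℕ.^ k)) (cong (ι a *_) (ι-^ a k))

  ι-nonneg : ∀ n → 0# ≤ ι n
  ι-pos : ∀ n → 0# < ι (suc n)

  ι-nonneg zero    = ≤-refl
  ι-nonneg (suc n) = inj₁ (ι-pos n)

  ι-pos n = begin-strict
    0#         ≡⟨ sym (+-identityʳ 0#) ⟩
    0# + 0#    <⟨ +-mono-< 0# 0<1 ⟩
    1# + 0#    ≤⟨ +-monoʳ-≤ 1# (ι-nonneg n) ⟩
    1# + ι n   ∎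
    where open ≤-Reasoning

  ι-mono : ∀ {a b} → a ℕ.≤ b → ι a ≤ ι b
  ι-mono {b = b} z≤n = ι-nonneg b
  ι-mono (s≤s a≤b)   = +-monoʳ-≤ 1# (ι-mono a≤b)

  ι!-pos : ∀ k → 0# < ι (k ℕ.!)
  ι!-pos k = <-≤-trans (ι-pos 0) (ι-mono (NP.1≤n! k))

  ^-nonneg : ∀ {x} k → 0# ≤ x → 0# ≤ x ^ k
  ^-nonneg zero    _   = inj₁ 0<1
  ^-nonneg (suc k) 0≤x = *-nonneg 0≤x (^-nonneg k 0≤x)

  ^-pos : ∀ {x} k → 0# < x → 0# < x ^ k
  ^-pos zero    _   = 0<1
  ^-pos (suc k) 0<x = *-pos 0<x (^-pos k 0<x)

  -- p^p > 0 for every p, including 0^0 = 1.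
  p^p-pos : ∀ p → 0# < ι p ^ p
  p^p-pos zero    = 0<1
  p^p-pos (suc r) = ^-pos (suc r) (ι-pos r)

  1^k≡1 : ∀ k → 1# ^ k ≡ 1#
  1^k≡1 zero    = refl
  1^k≡1 (suc k) = trans (*-identityˡ (1# ^ k)) (1^k≡1 k)

  sum-cong : ∀ lo len {f g : ℕ → R} → (∀ k → f k ≡ g k) → sumFrom lo len f ≡ sumFrom lo len g
  sum-cong lo zero      f≡g = refl
  sum-cong lo (suc len) f≡g = cong₂ _+_ (f≡g lo) (sum-cong (suc lo) len f≡g)

  sum-zero : ∀ lo len {f : ℕ → R} → (∀ k → f k ≡ 0#) → sumFrom lo len f ≡ 0#
  sum-zero lo zero      f≡0 = refl
  sum-zero lo (suc len) f≡0 = trans (cong₂ _+_ (f≡0 lo) (sum-zero (suc lo) len f≡0)) (+-identityˡ 0#)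

  sum-nonneg : ∀ lo len {f : ℕ → R} → (∀ k → 0# ≤ f k) → 0# ≤ sumFrom lo len f
  sum-nonneg lo zero      f≥0 = ≤-refl
  sum-nonneg lo (suc len) f≥0 = +-nonneg (f≥0 lo) (sum-nonneg (suc lo) len f≥0)

  sum-mono : ∀ lo len {f g : ℕ → R} → (∀ k → lo ℕ.≤ k → k ℕ.< lo ℕ.+ len → f k ≤ g k) →
             sumFrom lo len f ≤ sumFrom lo len g
  sum-mono lo zero      f≤g = ≤-refl
  sum-mono lo (suc len) f≤g =
    +-mono-≤ (f≤g lo NP.≤-refl (NP.m<m+n lo (s≤s z≤n)))
             (sum-mono (suc lo) len (λ k lo<k k<top → f≤g k (NP.<⇒≤ lo<k) (subst (k ℕ.<_) (sym (NP.+-suc lo len)) k<top)))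

  sum-add : ∀ lo len (f g : ℕ → R) → sumFrom lo len (λ k → f k + g k) ≡ sumFrom lo len f + sumFrom lo len g
  sum-add lo zero      f g = sym (+-identityˡ 0#)
  sum-add lo (suc len) f g =
    trans (cong (f lo + g lo +_) (sum-add (suc lo) len f g))
          (solve 4 (λ a b c d → (a :+ b) :+ (c :+ d) := (a :+ c) :+ (b :+ d)) refl
                 (f lo) (g lo) (sumFrom (suc lo) len f) (sumFrom (suc lo) len g))

  sum-scale : ∀ lo len c (f : ℕ → R) → sumFrom lo len (λ k → c * f k) ≡ c * sumFrom lo len f
  sum-scale lo zero      c f = sym (zeroʳ c)
  sum-scale lo (suc len) c f =
    trans (cong (c * f lo +_) (sum-scale (suc lo) len c f)) (sym (distribˡ c (f lo) _))

  sum-shift : ∀ lo len (f : ℕ → R) → sumFrom (suc lo) len f ≡ sumFrom lo len (λ k → f (suc k))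
  sum-shift lo zero      f = refl
  sum-shift lo (suc len) f = cong (f (suc lo) +_) (sum-shift (suc lo) len f)

  sum-split : ∀ lo i j (f : ℕ → R) → sumFrom lo (i ℕ.+ j) f ≡ sumFrom lo i f + sumFrom (lo ℕ.+ i) j f
  sum-split lo zero    j f rewrite NP.+-identityʳ lo = sym (+-identityˡ _)
  sum-split lo (suc i) j f rewrite NP.+-suc lo i =
    trans (cong (f lo +_) (sum-split (suc lo) i j f)) (sym (+-assoc (f lo) _ _))

  sum-snoc : ∀ lo len (f : ℕ → R) → sumFrom lo (suc len) f ≡ sumFrom lo len f + f (lo ℕ.+ len)
  sum-snoc lo len f = begin
    sumFrom lo (suc len) f                    ≡⟨ cong (λ t → sumFrom lo t f) (NP.+-comm 1 len) ⟩
    sumFrom lo (len ℕ.+ 1) f                  ≡⟨ sum-split lo len 1 f ⟩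
    sumFrom lo len f + (f (lo ℕ.+ len) + 0#)  ≡⟨ cong (sumFrom lo len f +_) (+-identityʳ _) ⟩
    sumFrom lo len f + f (lo ℕ.+ len)         ∎
    where open ≡-Reasoning

  -- The binomial theorem, with the sum running to any N ≥ i
  -- (the terms with k > i vanish).
  binomialTerm : R → ℕ → ℕ → R
  binomialTerm y i k = ι (binom i k) * y ^ k

  binomialTheorem : ∀ y i N → i ℕ.≤ N → (1# + y) ^ i ≡ sumFrom 0 (suc N) (binomialTerm y i)
  binomialTheorem y zero N _ = sym (begin
    ι 1 * 1# + sumFrom 1 N (binomialTerm y 0)
      ≡⟨ cong (ι 1 * 1# +_) (trans (sum-shift 0 N (binomialTerm y 0)) (sum-zero 0 N (λ k → zeroˡ (y ^ suc k)))) ⟩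
    ι 1 * 1# + 0#
      ≡⟨ trans (+-identityʳ _) (trans (*-identityʳ (ι 1)) (+-identityʳ 1#)) ⟩
    1# ∎)
    where open ≡-Reasoning
  binomialTheorem y (suc i) (suc N) (s≤s i≤N) = begin
    (1# + y) * B
      ≡⟨ solve 2 (λ y B → (con 1 :+ y) :* B := B :+ y :* B) refl y B ⟩
    B + y * B
      ≡⟨ cong (_+ y * B) (binomialTheorem y i (suc N) (NP.m≤n⇒m≤1+n i≤N)) ⟩
    (t 0 + rest) + y * B
      ≡⟨ solve 4 (λ a r y B → (a :+ r) :+ y :* B := a :+ (y :* B :+ r)) refl (t 0) rest y B ⟩
    t 0 + (y * B + rest)
      ≡⟨ cong (t 0 +_) (sym pascal) ⟩
    binomialTerm y (suc i) 0 + sumFrom 1 (suc N) (binomialTerm y (suc i)) ∎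
    where
    open ≡-Reasoning
    B = (1# + y) ^ i
    t = binomialTerm y i
    rest = sumFrom 1 (suc N) t
    pascalTerm : ∀ k → binomialTerm y (suc i) (suc k) ≡ y * t k + t (suc k)
    pascalTerm k =
      trans (cong (_* (y * y ^ k)) (ι-+ (binom i k) (binom i (suc k))))
            (solve 4 (λ a b y q → (a :+ b) :* (y :* q) := y :* (a :* q) :+ b :* (y :* q)) refl
                   (ι (binom i k)) (ι (binom i (suc k))) y (y ^ k))
    pascal : sumFrom 1 (suc N) (binomialTerm y (suc i)) ≡ y * B + rest
    pascal = begin
      sumFrom 1 (suc N) (binomialTerm y (suc i))
        ≡⟨ sum-shift 0 (suc N) (binomialTerm y (suc i)) ⟩
      sumFrom 0 (suc N) (λ k → binomialTerm y (suc i) (suc k))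
        ≡⟨ sum-cong 0 (suc N) pascalTerm ⟩
      sumFrom 0 (suc N) (λ k → y * t k + t (suc k))
        ≡⟨ sum-add 0 (suc N) (λ k → y * t k) (λ k → t (suc k)) ⟩
      sumFrom 0 (suc N) (λ k → y * t k) + sumFrom 0 (suc N) (λ k → t (suc k))
        ≡⟨ cong₂ _+_ (trans (sum-scale 0 (suc N) y t) (cong (y *_) (sym (binomialTheorem y i N i≤N))))
                     (sym (sum-shift 0 (suc N) t)) ⟩
      y * B + rest ∎

  binomialTerm≤ : ∀ p y → ι p * y ≡ 1# → 0# ≤ y → ∀ k → binomialTerm y p k ≤ ι (k ℕ.!) ⁻¹
  binomialTerm≤ p y py≡1 0≤y k = begin
    c * y ^ k                             ≡⟨ cancel-k! (c * y ^ k) ⟨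
    ((c * y ^ k) * f) * f ⁻¹              ≡⟨ cong (_* f ⁻¹) (solve 3 (λ c q f → (c :* q) :* f := (c :* f) :* q) refl c (y ^ k) f) ⟩
    ((c * f) * y ^ k) * f ⁻¹              ≤⟨ *-monoʳ-≤ (inj₁ (⁻¹-pos (ι!-pos k))) (*-monoʳ-≤ (^-nonneg k 0≤y) cf≤p^k) ⟩
    ((ι p ^ k) * y ^ k) * f ⁻¹            ≡⟨ cong (_* f ⁻¹) (sym (^-distrib-* (ι p) y k)) ⟩
    ((ι p * y) ^ k) * f ⁻¹                ≡⟨ cong (λ u → u ^ k * f ⁻¹) py≡1 ⟩
    (1# ^ k) * f ⁻¹                       ≡⟨ trans (cong (_* f ⁻¹) (1^k≡1 k)) (*-identityˡ (f ⁻¹)) ⟩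
    f ⁻¹                                  ∎
    where
    open ≤-Reasoning
    c = ι (binom p k)
    f = ι (k ℕ.!)
    cf≤p^k : c * f ≤ ι p ^ k
    cf≤p^k = subst₂ _≤_ (ι-* (binom p k) (k ℕ.!)) (ι-^ p k) (ι-mono (binom*!≤^ p k))
    cancel-k! : ∀ u → (u * f) * f ⁻¹ ≡ u
    cancel-k! u = trans (*-assoc u f (f ⁻¹)) (trans (cong (u *_) (⁻¹-inverse f (pos⇒≢0 (ι!-pos k)))) (*-identityʳ u))

  lowTermsSlack-ι : ∀ r → let p = suc r; n = suc p; c2 = ι (binom p 2); c3 = ι (binom p 3) in
    ι 6 * ι n * ι p * c2 + ι 6 * ι n * c3 + ι 6 * ι p * ι p * ι p ≤ ι 4 * ι p * ι p * ι p * ι n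
  lowTermsSlack-ι r = subst₂ _≤_ ιLeft ιRight (ι-mono (lowTermsSlack p (s≤s z≤n)))
    where
    p = suc r
    n = suc p
    ιLeft : ι (6 ℕ.* n ℕ.* p ℕ.* binom p 2 ℕ.+ 6 ℕ.* n ℕ.* binom p 3 ℕ.+ 6 ℕ.* p ℕ.* p ℕ.* p)
            ≡ ι 6 * ι n * ι p * ι (binom p 2) + ι 6 * ι n * ι (binom p 3) + ι 6 * ι p * ι p * ι p
    ιLeft = trans (ι-+ (6 ℕ.* n ℕ.* p ℕ.* binom p 2 ℕ.+ 6 ℕ.* n ℕ.* binom p 3) (6 ℕ.* p ℕ.* p ℕ.* p))
                  (cong₂ _+_ (trans (ι-+ (6 ℕ.* n ℕ.* p ℕ.* binom p 2) (6 ℕ.* n ℕ.* binom p 3))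
                                    (cong₂ _+_ (ι-*₄ 6 n p (binom p 2)) (ι-*₃ 6 n (binom p 3))))
                             (ι-*₄ 6 p p p))
    ιRight : ι (4 ℕ.* p ℕ.* p ℕ.* p ℕ.* n) ≡ ι 4 * ι p * ι p * ι p * ι n
    ιRight = trans (ι-* (4 ℕ.* p ℕ.* p ℕ.* p) n) (cong (_* ι n) (ι-*₄ 4 p p p))

  -- This is lowTermsSlack
  -- multiplied by y³z/6, where y = 1/p and z = 1/(p+1).
  lowTermsAbsorb : ∀ r y z → ι (suc r) * y ≡ 1# → ι (suc (suc r)) * z ≡ 1# → 0# ≤ y → 0# ≤ z →
    binomialTerm y (suc r) 2 + binomialTerm y (suc r) 3 + z ≤ ι (2 ℕ.!) ⁻¹ + ι (3 ℕ.!) ⁻¹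
  lowTermsAbsorb r y z py≡1 nz≡1 0≤y 0≤z = begin
    c2 * y ^ 2 + c3 * y ^ 3 + z
      ≡⟨ scaledLeft ⟨
    (six * ι n * ι p * c2 + six * ι n * c3 + six * ι p * ι p * ι p) * K
      ≤⟨ *-monoʳ-≤ 0≤K (lowTermsSlack-ι r) ⟩
    (ι 4 * ι p * ι p * ι p * ι n) * K
      ≡⟨ scaledRight ⟩
    ι 2 ⁻¹ + s ∎
    where
    open ≤-Reasoning
    p = suc r
    n = suc p
    six = ι 6
    s = six ⁻¹
    c2 = ι (binom p 2)
    c3 = ι (binom p 3)
    K = s * (y ^ 3 * z)
    six*s≡1 : six * s ≡ 1#
    six*s≡1 = ⁻¹-inverse six (pos⇒≢0 (ι-pos 5))
    0≤K : 0# ≤ K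
    0≤K = *-nonneg (inj₁ (⁻¹-pos (ι-pos 5))) (*-nonneg (^-nonneg 3 0≤y) 0≤z)

    -- After regrouping, the left side only involves the products
    -- six·s, n·z and p·y, each of which equals 1.
    regrouped : R → R → R → R
    regrouped u v w = c2 * y ^ 2 * (u * v * w) + c3 * y ^ 3 * (u * v) + z * (u * w * w * w)
    scaledLeft : (six * ι n * ι p * c2 + six * ι n * c3 + six * ι p * ι p * ι p) * K ≡ c2 * y ^ 2 + c3 * y ^ 3 + z
    scaledLeft = begin-equality
      (six * ι n * ι p * c2 + six * ι n * c3 + six * ι p * ι p * ι p) * K
        ≡⟨ solve 8 (λ six n p c2 c3 s y z →
             (six :* n :* p :* c2 :+ six :* n :* c3 :+ six :* p :* p :* p) :* (s :* ((y :* (y :* (y :* con 1))) :* z))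
             := c2 :* (y :* (y :* con 1)) :* ((six :* s) :* (n :* z) :* (p :* y))
                :+ c3 :* (y :* (y :* (y :* con 1))) :* ((six :* s) :* (n :* z))
                :+ z :* ((six :* s) :* (p :* y) :* (p :* y) :* (p :* y)))
             refl six (ι n) (ι p) c2 c3 s y z ⟩
      regrouped (six * s) (ι n * z) (ι p * y)
        ≡⟨ cong₃ regrouped six*s≡1 nz≡1 py≡1 ⟩
      regrouped 1# 1# 1#
        ≡⟨ solve 3 (λ a b z → a :* (con 1 :* con 1 :* con 1) :+ b :* (con 1 :* con 1)
                                :+ z :* (con 1 :* con 1 :* con 1 :* con 1) := a :+ b :+ z)
                   refl (c2 * y ^ 2) (c3 * y ^ 3) z ⟩
      c2 * y ^ 2 + c3 * y ^ 3 + z ∎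

    -- 4/6 = 1/2 + 1/6, using 3·(1/6) = 1/2.
    half : ι 2 ⁻¹ ≡ ι 3 * s
    half = sym (⁻¹-unique (ι-pos 1) (trans (sym (*-assoc (ι 2) (ι 3) s)) (trans (cong (_* s) (sym (ι-* 2 3))) six*s≡1)))
    scaledRight : (ι 4 * ι p * ι p * ι p * ι n) * K ≡ ι 2 ⁻¹ + s
    scaledRight = begin-equality
      (ι 4 * ι p * ι p * ι p * ι n) * K
        ≡⟨ solve 6 (λ four p n s y z →
             (four :* p :* p :* p :* n) :* (s :* ((y :* (y :* (y :* con 1))) :* z))
             := four :* s :* ((p :* y) :* (p :* y) :* (p :* y) :* (n :* z)))
             refl (ι 4) (ι p) (ι n) s y z ⟩
      ι 4 * s * ((ι p * y) * (ι p * y) * (ι p * y) * (ι n * z))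
        ≡⟨ cong₂ (λ u v → ι 4 * s * (u * u * u * v)) py≡1 nz≡1 ⟩
      (1# + ι 3) * s * (1# * 1# * 1# * 1#)
        ≡⟨ solve 2 (λ t s → (con 1 :+ t) :* s :* (con 1 :* con 1 :* con 1 :* con 1) := t :* s :+ s) refl (ι 3) s ⟩
      ι 3 * s + s
        ≡⟨ cong (_+ s) (sym half) ⟩
      ι 2 ⁻¹ + s ∎

  eulerPartialSum : ℕ → R
  eulerPartialSum N = sumFrom 0 (suc N) (λ j → ι (j ℕ.!) ⁻¹)

  eulerPartialSum-nonneg : ∀ N → 0# ≤ eulerPartialSum N
  eulerPartialSum-nonneg N = sum-nonneg 0 (suc N) (λ j → inj₁ (⁻¹-pos (ι!-pos j)))

  -- (1 + 1/p)^p + 1/(p+1) ≤ Σ_{j=0}^{p+3} 1/j!: bound the binomial terms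
  -- one by one, letting the terms j = 2, 3 absorb 1/(p+1).
  compoundBound : ∀ r → let p = suc r in (1# + ι p ⁻¹) ^ p + ι (suc p) ⁻¹ ≤ eulerPartialSum (3 ℕ.+ p)
  compoundBound r = begin
    (1# + y) ^ p + z
      ≡⟨ cong (_+ z) (binomialTheorem y p (3 ℕ.+ p) (NP.m≤n+m p 3)) ⟩
    (t 0 + (t 1 + (t 2 + (t 3 + sumFrom 4 p t)))) + z
      ≡⟨ solve 6 (λ a b c d e z → (a :+ (b :+ (c :+ (d :+ e)))) :+ z := a :+ (b :+ ((c :+ d :+ z) :+ e))) refl
               (t 0) (t 1) (t 2) (t 3) (sumFrom 4 p t) z ⟩
    t 0 + (t 1 + ((t 2 + t 3 + z) + sumFrom 4 p t))
      ≤⟨ +-mono-≤ (term≤ 0) (+-mono-≤ (term≤ 1)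
           (+-mono-≤ (lowTermsAbsorb r y z py≡1 nz≡1 (inj₁ (⁻¹-pos (ι-pos r))) (inj₁ (⁻¹-pos (ι-pos p))))
                     (sum-mono 4 p (λ k _ _ → term≤ k)))) ⟩
    u 0 + (u 1 + ((u 2 + u 3) + sumFrom 4 p u))
      ≡⟨ solve 5 (λ a b c d e → a :+ (b :+ ((c :+ d) :+ e)) := a :+ (b :+ (c :+ (d :+ e)))) refl
               (u 0) (u 1) (u 2) (u 3) (sumFrom 4 p u) ⟩
    eulerPartialSum (3 ℕ.+ p) ∎
    where
    open ≤-Reasoning
    p = suc r
    y = ι p ⁻¹
    z = ι (suc p) ⁻¹
    py≡1 : ι p * y ≡ 1#
    py≡1 = ⁻¹-inverse (ι p) (pos⇒≢0 (ι-pos r))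
    nz≡1 : ι (suc p) * z ≡ 1#
    nz≡1 = ⁻¹-inverse (ι (suc p)) (pos⇒≢0 (ι-pos p))
    t = binomialTerm y p
    u : ℕ → R
    u j = ι (j ℕ.!) ⁻¹
    term≤ : ∀ k → t k ≤ u k
    term≤ = binomialTerm≤ p y py≡1 (inj₁ (⁻¹-pos (ι-pos r)))

  -- compoundBound multiplied by n·p^p, where n = p + 1 (and checked
  -- directly for p = 0):  n^(p+1) + p^p ≤ n·p^p·Σ_{j=0}^{p+3} 1/j!.
  scaledEulerBound : ∀ p → ι (suc p) ^ suc p + ι p ^ p ≤ ι (suc p) * ι p ^ p * eulerPartialSum (3 ℕ.+ p)
  scaledEulerBound zero = begin
    ι 1 * 1# + 1#                          ≡⟨ cong (_+ 1#) ι1*1≡1 ⟩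
    1# + 1#                                ≡⟨ cong (1# +_) (+-identityʳ 1#) ⟨
    1# + (1# + 0#)                         ≤⟨ +-monoʳ-≤ 1# (+-monoʳ-≤ 1# rest≥0) ⟩
    1# + (1# + rest)                       ≡⟨ cong₂ (λ a b → a + (b + rest)) 1≡ι1⁻¹ 1≡ι1⁻¹ ⟩
    eulerPartialSum 3                      ≡⟨ trans (cong (_* eulerPartialSum 3) ι1*1≡1) (*-identityˡ _) ⟨
    ι 1 * 1# * eulerPartialSum 3           ∎
    where
    open ≤-Reasoning
    ι1*1≡1 : ι 1 * 1# ≡ 1#
    ι1*1≡1 = trans (*-identityʳ (ι 1)) (+-identityʳ 1#)
    1≡ι1⁻¹ : 1# ≡ ι 1 ⁻¹
    1≡ι1⁻¹ = ⁻¹-unique (ι-pos 0) ι1*1≡1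
    rest = ι (2 ℕ.!) ⁻¹ + (ι (3 ℕ.!) ⁻¹ + 0#)
    rest≥0 : 0# ≤ rest
    rest≥0 = +-nonneg (inj₁ (⁻¹-pos (ι!-pos 2))) (+-nonneg (inj₁ (⁻¹-pos (ι!-pos 3))) ≤-refl)
  scaledEulerBound p@(suc r) = begin
    ι n ^ suc p + P                    ≡⟨ cong (_+ P) (cong (ι n *_) n^p≡P*B) ⟩
    ι n * (P * B) + P                  ≡⟨ scale ⟨
    ι n * P * (B + z)                  ≤⟨ *-monoˡ-≤ (*-nonneg (ι-nonneg n) (^-nonneg p (ι-nonneg p))) (compoundBound r) ⟩
    ι n * P * eulerPartialSum (3 ℕ.+ p) ∎
    where
    open ≤-Reasoning
    n = suc p
    y = ι p ⁻¹
    z = ι n ⁻¹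
    P = ι p ^ p
    B = (1# + y) ^ p
    -- n = p·(1 + 1/p), hence n^p = p^p·(1 + 1/p)^p.
    n≡p*[1+y] : ι n ≡ ι p * (1# + y)
    n≡p*[1+y] = sym (begin-equality
      ι p * (1# + y)       ≡⟨ distribˡ (ι p) 1# y ⟩
      ι p * 1# + ι p * y   ≡⟨ cong₂ _+_ (*-identityʳ (ι p)) (⁻¹-inverse (ι p) (pos⇒≢0 (ι-pos r))) ⟩
      ι p + 1#             ≡⟨ +-comm (ι p) 1# ⟩
      ι n                  ∎)
    n^p≡P*B : ι n ^ p ≡ P * B
    n^p≡P*B = trans (cong (_^ p) n≡p*[1+y]) (^-distrib-* (ι p) (1# + y) p)
    scale : ι n * P * (B + z) ≡ ι n * (P * B) + P
    scale = trans (solve 4 (λ n P B z → n :* P :* (B :+ z) := n :* (P :* B) :+ P :* (n :* z)) refl (ι n) P B z)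
                  (cong (ι n * (P * B) +_) (trans (cong (P *_) (⁻¹-inverse (ι n) (pos⇒≢0 (ι-pos p)))) (*-identityʳ P)))

  geometricTail : ∀ x (f : ℕ → R) → 0# ≤ x → ∀ len lo →
    (∀ k → lo ℕ.≤ k → k ℕ.< lo ℕ.+ len → (1# + x) * f (suc k) ≤ x * f k) →
    (∀ k → lo ℕ.≤ k → k ℕ.≤ lo ℕ.+ len → 0# ≤ f k) →
    sumFrom lo (suc len) f ≤ (1# + x) * f lo
  geometricTail x f 0≤x zero lo _ f≥0 = begin
    f lo + 0#              ≡⟨ solve 1 (λ u → u :+ con 0 := con 1 :* u :+ con 0) refl (f lo) ⟩
    1# * f lo + 0#         ≤⟨ +-monoʳ-≤ (1# * f lo) (*-nonneg 0≤x (f≥0 lo NP.≤-refl (NP.m≤m+n lo 0))) ⟩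
    1# * f lo + x * f lo   ≡⟨ distribʳ (f lo) 1# x ⟨
    (1# + x) * f lo        ∎
    where open ≤-Reasoning
  geometricTail x f 0≤x (suc len) lo decay f≥0 = begin
    f lo + sumFrom (suc lo) (suc len) f  ≤⟨ +-monoʳ-≤ (f lo) (geometricTail x f 0≤x len (suc lo) decay′ f≥0′) ⟩
    f lo + (1# + x) * f (suc lo)         ≤⟨ +-monoʳ-≤ (f lo) (decay lo NP.≤-refl (NP.m<m+n lo (s≤s z≤n))) ⟩
    f lo + x * f lo                      ≡⟨ solve 2 (λ u x → u :+ x :* u := (con 1 :+ x) :* u) refl (f lo) x ⟩
    (1# + x) * f lo                      ∎
    where
    open ≤-Reasoning
    top≡ : lo ℕ.+ suc len ≡ suc (lo ℕ.+ len)
    top≡ = NP.+-suc lo len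
    decay′ : ∀ k → suc lo ℕ.≤ k → k ℕ.< suc lo ℕ.+ len → (1# + x) * f (suc k) ≤ x * f k
    decay′ k lo<k k<top = decay k (NP.<⇒≤ lo<k) (subst (k ℕ.<_) (sym top≡) k<top)
    f≥0′ : ∀ k → suc lo ℕ.≤ k → k ℕ.≤ suc lo ℕ.+ len → 0# ≤ f k
    f≥0′ k lo<k k≤top = f≥0 k (NP.<⇒≤ lo<k) (subst (k ℕ.≤_) (sym top≡) k≤top)

  -- The weight Σ_{i<J} x^(J-i)·y^i of the geometric growth bound below.
  mixedPowerSum : R → R → ℕ → R
  mixedPowerSum x y zero    = 0#
  mixedPowerSum x y (suc J) = x * (mixedPowerSum x y J + y ^ J)

  mixedPowerSum-nonneg : ∀ {x y} → 0# ≤ x → 0# ≤ y → ∀ J → 0# ≤ mixedPowerSum x y J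
  mixedPowerSum-nonneg 0≤x 0≤y zero    = ≤-refl
  mixedPowerSum-nonneg 0≤x 0≤y (suc J) =
    *-nonneg 0≤x (+-nonneg (mixedPowerSum-nonneg 0≤x 0≤y J) (^-nonneg J 0≤y))

  mixedPowerSum-closed : ∀ y J → let x = 1# + y in mixedPowerSum x y J + x * y ^ J ≡ x ^ suc J
  mixedPowerSum-closed y zero    = +-identityˡ _
  mixedPowerSum-closed y (suc J) = begin
    x * (G + y ^ J) + x * (y * y ^ J)  ≡⟨ solve 3 (λ y G q → (con 1 :+ y) :* (G :+ q) :+ (con 1 :+ y) :* (y :* q)
                                                       := (con 1 :+ y) :* (G :+ (con 1 :+ y) :* q)) refl y G (y ^ J) ⟩
    x * (G + x * y ^ J)                ≡⟨ cong (x *_) (mixedPowerSum-closed y J) ⟩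
    x * x ^ suc J                      ∎
    where
    open ≡-Reasoning
    x = 1# + y
    G = mixedPowerSum x y J

  geometricHead : ∀ {x y} (f : ℕ → R) → 0# ≤ x → 0# ≤ y → ∀ lo J →
    (∀ k → lo ℕ.≤ k → k ℕ.< lo ℕ.+ J → y * f k ≤ x * f (suc k)) →
    y ^ J * sumFrom lo J f ≤ mixedPowerSum x y J * f (lo ℕ.+ J)
  geometricHead {x} {y} f 0≤x 0≤y lo zero _ =
    ≤-reflexive (trans (zeroʳ 1#) (sym (zeroˡ (f (lo ℕ.+ 0)))))
  geometricHead {x} {y} f 0≤x 0≤y lo (suc J) growth = begin
    y ^ suc J * sumFrom lo (suc J) f
      ≡⟨ cong (y ^ suc J *_) (sum-snoc lo J f) ⟩
    y * y ^ J * (S + f t)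
      ≡⟨ solve 4 (λ y q S u → y :* q :* (S :+ u) := y :* (q :* S) :+ q :* (y :* u)) refl y (y ^ J) S (f t) ⟩
    y * (y ^ J * S) + y ^ J * (y * f t)
      ≤⟨ +-mono-≤ (*-monoˡ-≤ 0≤y (geometricHead f 0≤x 0≤y lo J growth′)) (*-monoˡ-≤ (^-nonneg J 0≤y) step) ⟩
    y * (G * f t) + y ^ J * (x * f (suc t))
      ≡⟨ cong (_+ y ^ J * (x * f (suc t))) (solve 3 (λ y G u → y :* (G :* u) := G :* (y :* u)) refl y G (f t)) ⟩
    G * (y * f t) + y ^ J * (x * f (suc t))
      ≤⟨ +-monoˡ-≤ (y ^ J * (x * f (suc t))) (*-monoˡ-≤ (mixedPowerSum-nonneg 0≤x 0≤y J) step) ⟩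
    G * (x * f (suc t)) + y ^ J * (x * f (suc t))
      ≡⟨ solve 4 (λ G x u q → G :* (x :* u) :+ q :* (x :* u) := x :* (G :+ q) :* u) refl G x (f (suc t)) (y ^ J) ⟩
    mixedPowerSum x y (suc J) * f (suc t)
      ≡⟨ cong (λ i → mixedPowerSum x y (suc J) * f i) (NP.+-suc lo J) ⟨
    mixedPowerSum x y (suc J) * f (lo ℕ.+ suc J) ∎
    where
    open ≤-Reasoning
    t = lo ℕ.+ J
    S = sumFrom lo J f
    G = mixedPowerSum x y J
    growth′ : ∀ k → lo ℕ.≤ k → k ℕ.< t → y * f k ≤ x * f (suc k)
    growth′ k lo≤k k<t = growth k lo≤k (subst (k ℕ.<_) (sym (NP.+-suc lo J)) (NP.m<n⇒m<1+n k<t))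
    step : y * f t ≤ x * f (suc t)
    step = growth t (NP.m≤m+n lo J) (subst (t ℕ.<_) (sym (NP.+-suc lo J)) (NP.n<1+n t))

  MaximumOn : (ℕ → R) → ℕ → ℕ → Set
  MaximumOn g m n = 1 ℕ.≤ n × n ℕ.≤ m × (∀ k → 1 ℕ.≤ k → k ℕ.≤ m → g k ≤ g n)

  argmax : ∀ (g : ℕ → R) m → 1 ℕ.≤ m → ∃ (MaximumOn g m)
  argmax g (suc zero)    _ = 1 , NP.≤-refl , NP.≤-refl , only1
    where
    only1 : ∀ k → 1 ℕ.≤ k → k ℕ.≤ 1 → g k ≤ g 1
    only1 k 1≤k k≤1 = ≤-reflexive (cong g (NP.≤-antisym k≤1 1≤k))
  argmax g (suc (suc m)) _ with argmax g (suc m) (s≤s z≤n)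
  ... | n , 1≤n , n≤m , max with ≤-or-> (g (suc (suc m))) (g n)
  ...   | inj₁ last≤ = n , 1≤n , NP.m≤n⇒m≤1+n n≤m , extend
    where
    extend : ∀ k → 1 ℕ.≤ k → k ℕ.≤ suc (suc m) → g k ≤ g n
    extend k 1≤k k≤ with NP.m≤n⇒m<n∨m≡n k≤
    ... | inj₁ k< = max k 1≤k (NP.≤-pred k<)
    ... | inj₂ refl = last≤
  ...   | inj₂ <last = suc (suc m) , s≤s z≤n , NP.≤-refl , extend
    where
    extend : ∀ k → 1 ℕ.≤ k → k ℕ.≤ suc (suc m) → g k ≤ g (suc (suc m))
    extend k 1≤k k≤ with NP.m≤n⇒m<n∨m≡n k≤
    ... | inj₁ k< = inj₁ (≤-<-trans (max k 1≤k (NP.≤-pred k<)) <last)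
    ... | inj₂ refl = ≤-refl

  -- Log-concavity with consecutive support makes the ratios a_{k+1}/a_k
  -- non-increasing, in the division-free form a_i·a_{j+1} ≤ a_{i+1}·a_j
  -- for 1 ≤ i ≤ j < m.  Zeros are harmless: if a_i or a_{j+1} vanishes the
  -- left side is 0, and otherwise everything in between is positive.
  ratio-antitone : ∀ {m} {a : ℕ → R} → LogConcave m a →
    ∀ {i j} → 1 ℕ.≤ i → i ℕ.≤ j → suc j ℕ.≤ m → a i * a (suc j) ≤ a (suc i) * a j
  ratio-antitone {m} {a} (nonneg , logConcave , support) {i} {j} 1≤i i≤j j<m =
    subst (λ t → a i * a (suc t) ≤ a (suc i) * a t) (NP.m∸n+n≡m i≤j)
          (byGap (j ∸ i) (subst (λ t → suc t ℕ.≤ m) (sym (NP.m∸n+n≡m i≤j)) j<m))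
    where
    byGap : ∀ d → suc (d ℕ.+ i) ℕ.≤ m → a i * a (suc (d ℕ.+ i)) ≤ a (suc i) * a (d ℕ.+ i)
    byGap zero    _    = ≤-reflexive (*-comm (a i) (a (suc i)))
    byGap (suc d) k<m  = bySign (nonneg i 1≤i i≤m) (nonneg (suc k) (s≤s z≤n) k<m)
      where
      j′ = d ℕ.+ i
      k = suc j′
      k≤m : k ℕ.≤ m
      k≤m = NP.≤-trans (NP.n≤1+n k) k<m
      i≤m : i ℕ.≤ m
      i≤m = NP.≤-trans (NP.≤-trans (NP.m≤n+m i d) (NP.n≤1+n j′)) k≤m
      0≤aₛᵢ : 0# ≤ a (suc i)
      0≤aₛᵢ = nonneg (suc i) (s≤s z≤n) (NP.≤-trans (s≤s (NP.m≤n+m i d)) k≤m)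
      rhs≥0 : 0# ≤ a (suc i) * a k
      rhs≥0 = *-nonneg 0≤aₛᵢ (nonneg k (s≤s z≤n) k≤m)

      bySign : 0# ≤ a i → 0# ≤ a (suc k) → a i * a (suc k) ≤ a (suc i) * a k
      bySign (inj₂ 0≡aᵢ) _ =
        subst (λ u → u * a (suc k) ≤ a (suc i) * a k) 0≡aᵢ (≤-trans (≤-reflexive (zeroˡ (a (suc k)))) rhs≥0)
      bySign _ (inj₂ 0≡aₖ₊₁) =
        subst (λ u → a i * u ≤ a (suc i) * a k) 0≡aₖ₊₁ (≤-trans (≤-reflexive (zeroʳ (a i))) rhs≥0)
      bySign (inj₁ 0<aᵢ) (inj₁ 0<aₖ₊₁) = *-cancelˡ-≤ (*-pos 0<aⱼ 0<aₖ) (begin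
        (a j′ * a k) * (a i * a (suc k))         ≡⟨ solve 4 (λ u v w z → (u :* v) :* (w :* z) := (w :* v) :* (u :* z)) refl (a j′) (a k) (a i) (a (suc k)) ⟩
        (a i * a k) * (a j′ * a (suc k))         ≤⟨ *-monoʳ-≤ (*-nonneg (inj₁ 0<aⱼ) (inj₁ 0<aₖ₊₁)) (byGap d k≤m) ⟩
        (a (suc i) * a j′) * (a j′ * a (suc k))  ≤⟨ *-monoˡ-≤ (*-nonneg 0≤aₛᵢ (inj₁ 0<aⱼ)) (logConcave k (s≤s 1≤j′) k<m) ⟩
        (a (suc i) * a j′) * (a k * a k)         ≡⟨ solve 3 (λ u v w → (u :* v) :* (w :* w) := (v :* w) :* (u :* w)) refl (a (suc i)) (a j′) (a k) ⟩
        (a j′ * a k) * (a (suc i) * a k)         ∎)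
        where
        open ≤-Reasoning
        1≤j′ : 1 ℕ.≤ j′
        1≤j′ = NP.≤-trans 1≤i (NP.m≤n+m i d)
        0<aₖ : 0# < a k
        0<aₖ = support i k (suc k) 1≤i (NP.≤-trans (NP.m≤n+m i d) (NP.n≤1+n j′)) (NP.n≤1+n k) k<m 0<aᵢ 0<aₖ₊₁
        0<aⱼ : 0# < a j′
        0<aⱼ = support i j′ (suc k) 1≤i (NP.m≤n+m i d) (NP.≤-trans (NP.n≤1+n j′) (NP.n≤1+n k)) k<m 0<aᵢ 0<aₖ₊₁

  -- Let a be log-concave on [1, m], and let k·a_k be largest at k = n = p + 1,
  -- where a_n > 0 and n·a_n ≤ 1.  Then a_{k+1}/a_k ≥ p/n below n and
  -- a_{k+1}/a_k ≤ n/(n+1) from n on; summing both geometric bounds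
  -- dominates Σ a by a partial sum of e.
  module AtMaximum {m} {a : ℕ → R} (lc : LogConcave m a) (p : ℕ) (n≤m : suc p ℕ.≤ m)
                   (max : ∀ k → 1 ℕ.≤ k → k ℕ.≤ m → ι k * a k ≤ ι (suc p) * a (suc p))
                   (0<A : 0# < a (suc p)) (nA≤1 : ι (suc p) * a (suc p) ≤ 1#) where
    n = suc p
    A = a n

    growthBelow : ∀ k → 1 ℕ.≤ k → k ℕ.≤ p → ι p * a k ≤ ι n * a (suc k)
    growthBelow k 1≤k k≤p = *-cancelʳ-≤ 0<A (begin
      (ι p * a k) * A          ≡⟨ *-assoc (ι p) (a k) A ⟩
      ι p * (a k * A)          ≤⟨ *-monoˡ-≤ (ι-nonneg p) (ratio-antitone lc 1≤k k≤p n≤m) ⟩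
      ι p * (a (suc k) * a p)  ≡⟨ solve 3 (λ x y z → x :* (y :* z) := y :* (x :* z)) refl (ι p) (a (suc k)) (a p) ⟩
      a (suc k) * (ι p * a p)  ≤⟨ *-monoˡ-≤ 0≤aₖ₊₁ (max p (NP.≤-trans 1≤k k≤p) (NP.≤-trans (NP.n≤1+n p) n≤m)) ⟩
      a (suc k) * (ι n * A)    ≡⟨ solve 3 (λ x y z → x :* (y :* z) := (y :* x) :* z) refl (a (suc k)) (ι n) A ⟩
      (ι n * a (suc k)) * A    ∎)
      where
      open ≤-Reasoning
      0≤aₖ₊₁ : 0# ≤ a (suc k)
      0≤aₖ₊₁ = proj₁ lc (suc k) (s≤s z≤n) (NP.≤-trans (s≤s k≤p) n≤m)

    decayAbove : ∀ k → n ℕ.≤ k → suc k ℕ.≤ m → ι (suc n) * a (suc k) ≤ ι n * a k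
    decayAbove k n≤k k<m = *-cancelʳ-≤ 0<A (begin
      (ι (suc n) * a (suc k)) * A   ≡⟨ solve 3 (λ x y z → (x :* y) :* z := x :* (z :* y)) refl (ι (suc n)) (a (suc k)) A ⟩
      ι (suc n) * (A * a (suc k))   ≤⟨ *-monoˡ-≤ (ι-nonneg (suc n)) (ratio-antitone lc (s≤s z≤n) n≤k k<m) ⟩
      ι (suc n) * (a (suc n) * a k) ≡⟨ solve 3 (λ x y z → x :* (y :* z) := z :* (x :* y)) refl (ι (suc n)) (a (suc n)) (a k) ⟩
      a k * (ι (suc n) * a (suc n)) ≤⟨ *-monoˡ-≤ 0≤aₖ (max (suc n) (s≤s z≤n) (NP.≤-trans (s≤s n≤k) k<m)) ⟩
      a k * (ι n * A)               ≡⟨ solve 3 (λ x y z → x :* (y :* z) := (y :* x) :* z) refl (a k) (ι n) A ⟩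
      (ι n * a k) * A               ∎)
      where
      open ≤-Reasoning
      0≤aₖ : 0# ≤ a k
      0≤aₖ = proj₁ lc k (NP.≤-trans (s≤s z≤n) n≤k) (NP.≤-trans (NP.n≤1+n k) k<m)

    -- n·p^p·Σ_{k=1}^{m} a_k ≤ n^(p+1) + p^p.  The head Σ_{k<n} is bounded by
    -- geometric growth, the tail Σ_{k≥n} by geometric decay, and n·A ≤ 1.
    scaledSumBound : ι n * ι p ^ p * sumFrom 1 m a ≤ ι n ^ suc p + ι p ^ p
    scaledSumBound = begin
      ι n * P * sumFrom 1 m a            ≡⟨ cong (ι n * P *_) split ⟩
      ι n * P * (head + tail)            ≡⟨ solve 4 (λ n P U T → n :* P :* (U :+ T) := n :* (P :* U) :+ n :* P :* T) refl (ι n) P head tail ⟩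
      ι n * (P * head) + ι n * P * tail  ≤⟨ +-mono-≤ (*-monoˡ-≤ (ι-nonneg n) headBound) (*-monoˡ-≤ (*-nonneg (ι-nonneg n) 0≤P) tailBound) ⟩
      ι n * (G * A) + ι n * P * ((1# + ι n) * A)
        ≡⟨ solve 4 (λ n A G P → n :* (G :* A) :+ n :* P :* ((con 1 :+ n) :* A) := (n :* A) :* (G :+ n :* P :+ P)) refl (ι n) A G P ⟩
      (ι n * A) * (G + ι n * P + P)      ≤⟨ *-monoʳ-≤ 0≤weight nA≤1 ⟩
      1# * (G + ι n * P + P)             ≡⟨ trans (*-identityˡ _) (cong (_+ P) (mixedPowerSum-closed (ι p) p)) ⟩
      ι n ^ suc p + P                    ∎
      where
      open ≤-Reasoning
      P = ι p ^ p
      0≤P : 0# ≤ P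
      0≤P = ^-nonneg p (ι-nonneg p)
      G = mixedPowerSum (ι n) (ι p) p
      0≤weight : 0# ≤ G + ι n * P + P
      0≤weight = +-nonneg (+-nonneg (mixedPowerSum-nonneg (ι-nonneg n) (ι-nonneg p) p) (*-nonneg (ι-nonneg n) 0≤P)) 0≤P
      len = m ∸ n
      n+len≡m : n ℕ.+ len ≡ m
      n+len≡m = NP.m+[n∸m]≡n n≤m
      head = sumFrom 1 p a
      tail = sumFrom n (suc len) a
      split : sumFrom 1 m a ≡ head + tail
      split = trans (cong (λ t → sumFrom 1 t a) (trans (sym n+len≡m) (sym (NP.+-suc p len))))
                    (sum-split 1 p (suc len) a)
      headBound : P * head ≤ G * A
      headBound = geometricHead a (ι-nonneg n) (ι-nonneg p) 1 p
                    (λ k 1≤k k<n → growthBelow k 1≤k (NP.≤-pred k<n))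
      tailBound : tail ≤ (1# + ι n) * A
      tailBound = geometricTail (ι n) a (ι-nonneg n) len n
                    (λ k n≤k k<top → decayAbove k n≤k (subst (suc k ℕ.≤_) n+len≡m k<top))
                    (λ k n≤k k≤top → proj₁ lc k (NP.≤-trans (s≤s z≤n) n≤k) (subst (k ℕ.≤_) n+len≡m k≤top))

    sum≤eulerPartialSum : sumFrom 1 m a ≤ eulerPartialSum (3 ℕ.+ p)
    sum≤eulerPartialSum =
      *-cancelˡ-≤ (*-pos (ι-pos p) (p^p-pos p)) (≤-trans scaledSumBound (scaledEulerBound p))

  -- Every log-concave sequence with a_k ≤ 1/k is dominated by a partial sum
  -- of e.  Take n maximising k·a_k; if a_n = 0 the whole sequence vanishes.
  sum≤someEulerPartialSum : ∀ m (a : ℕ → R) → LogConcave m a →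
    (∀ k → 1 ℕ.≤ k → k ℕ.≤ m → a k ≤ ι k ⁻¹) → ∃ λ N → sumFrom 1 m a ≤ eulerPartialSum N
  sum≤someEulerPartialSum zero    a _  _     = 0 , eulerPartialSum-nonneg 0
  sum≤someEulerPartialSum (suc m) a lc a≤1/k with argmax (λ k → ι k * a k) (suc m) (s≤s z≤n)
  ... | suc p , _ , n≤m , max with proj₁ lc (suc p) (s≤s z≤n) n≤m
  ...   | inj₁ 0<A = 3 ℕ.+ p , AtMaximum.sum≤eulerPartialSum lc p n≤m max 0<A nA≤1
    where
    nA≤1 : ι (suc p) * a (suc p) ≤ 1#
    nA≤1 = subst (ι (suc p) * a (suc p) ≤_) (⁻¹-inverse (ι (suc p)) (pos⇒≢0 (ι-pos p)))
                 (*-monoˡ-≤ (ι-nonneg (suc p)) (a≤1/k (suc p) (s≤s z≤n) n≤m))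
  ...   | inj₂ 0≡A = 0 , ≤-trans sum≤0 (eulerPartialSum-nonneg 0)
    where
    -- k·a_k ≤ n·a_n = 0 forces a_k ≤ 0.
    aₖ≤0 : ∀ k → 1 ℕ.≤ k → k ℕ.< 1 ℕ.+ suc m → a k ≤ 0#
    aₖ≤0 (suc k) _ k≤m = *-cancelˡ-≤ (ι-pos k)
      (subst (ι (suc k) * a (suc k) ≤_) (trans (cong (ι (suc p) *_) (sym 0≡A)) (trans (zeroʳ _) (sym (zeroʳ _))))
             (max (suc k) (s≤s z≤n) (NP.≤-pred k≤m)))
    sum≤0 : sumFrom 1 (suc m) a ≤ 0#
    sum≤0 = ≤-trans (sum-mono 1 (suc m) aₖ≤0) (≤-reflexive (sum-zero 1 (suc m) (λ _ → refl)))

  -- The partial sums of e increase strictly, so each lies strictly below e.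
  eulerPartialSum<e : ∀ {e} → IsEuler e → ∀ N → eulerPartialSum N < e
  eulerPartialSum<e isE N = <-≤-trans (begin-strict
    eulerPartialSum N                         ≡⟨ +-identityʳ _ ⟨
    eulerPartialSum N + 0#                    <⟨ +-monoʳ-< (eulerPartialSum N) (⁻¹-pos (ι!-pos (suc N))) ⟩
    eulerPartialSum N + ι (suc N ℕ.!) ⁻¹      ≡⟨ sum-snoc 0 (suc N) (λ j → ι (j ℕ.!) ⁻¹) ⟨
    eulerPartialSum (suc N)                   ∎) (proj₁ isE (eulerPartialSum (suc N)) (suc N , refl))
    where open ≤-Reasoning

lemma63 : (F : CompleteOrderedField) → let open CompleteOrderedField F in
    (e : R) → IsEuler e →
    (m : ℕ) (a : ℕ → R) → LogConcave m a →
    (∀ k → 1 ℕ.≤ k → k ℕ.≤ m → a k ≤ (ι k) ⁻¹) →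
    sumFrom 1 m a < e
lemma63 F e isEuler m a logConcave a≤1/k =
  ≤-<-trans F (proj₂ bound) (eulerPartialSum<e F isEuler (proj₁ bound))
  where bound = sum≤someEulerPartialSum F m a logConcave a≤1/k
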